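{- For all integers $d\ge 2$, we have $R_p(d)\le 2d-2$; that is, for every $n\ge 2d-1$, every labeling of the edges of ${\overset{\leftrightarrow}{K}}_n$ by permutations of $[d]$ has a fixed-point cycle.
   Context: For an integer $n\ge 1$, ${\overset{\leftrightarrow}{K}}_n$ denotes the complete bidirected graph on $n$ vertices: for every pair of distinct vertices $u,v$ it has both directed edges $(u,v)$ and $(v,u)$. Let $[d]=\{1,\dots,d\}$. A permutation $d$-labeling assigns to every directed edge $e$ a bijection $\ell_e:[d]\to[d]$. A cycle means a simple directed cycle. If a cycle has edges $e_1,\dots,e_k$ in this order with labels $f_1,\dots,f_k$, it is a fixed-point cycle if the map $x\mapsto f_k(f_{k-1}(\cdots f_1(x)\cdots))$ has a fixed point in $[d]$. $R_p(d)$ is the largest $n$ such that there exists a permutation $d$-labeling of ${\overset{\leftrightarrow}{K}}_n$ with no fixed-point cycle. -}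

module Defs where

open import Data.Nat using (ℕ; zero; suc)
open import Data.Nat.DivMod using (_mod_)
open import Data.Fin using (Fin; toℕ)
open import Data.Fin.Permutation using (Permutation′; _⟨$⟩ʳ_)
open import Data.List using (List; []; _∷_; allFin)
open import Data.Product using (Σ)
open import Function.Definitions using (Injective)
open import Relation.Binary.PropositionalEquality using (_≡_; _≢_)

Labeling : ℕ → ℕ → Set
Labeling n d = (u v : Fin n) → u ≢ v → Permutation′ d

next : ∀ {m} → Fin (suc m) → Fin (suc m)
next {m} i = suc (toℕ i) mod (suc m)

-- A simple directed cycle of length k = m + 2 ≥ 2 in the complete bidirected
-- graph on n vertices: pairwise distinct vertices vs 0, …, vs (k-1);
-- its edges are (vs i , vs (next i)).  The field 'adj' (consecutive vertices
-- distinct) follows from injectivity and is recorded so that edges can be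
-- looked up in the labeling.
record Cycle (n : ℕ) : Set where
  field
    m   : ℕ
    vs  : Fin (suc (suc m)) → Fin n
    inj : Injective _≡_ _≡_ vs
    adj : ∀ i → vs i ≢ vs (next i)
open Cycle public

run : ∀ {n d} → Labeling n d → (C : Cycle n) → List (Fin (suc (suc (m C)))) → Fin d → Fin d
run ℓ C [] x = x
run ℓ C (i ∷ is) x = run ℓ C is (ℓ (vs C i) (vs C (next i)) (adj C i) ⟨$⟩ʳ x)

cycleMap : ∀ {n d} → Labeling n d → Cycle n → Fin d → Fin d
cycleMap ℓ C = run ℓ C (allFin _)

FixedPointCycle : ∀ {n d} → Labeling n d → Cycle n → Set
FixedPointCycle {d = d} ℓ C = Σ (Fin d) λ x → cycleMap ℓ C x ≡ x

HasFixedPointCycle : ∀ {n d} → Labeling n d → Set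
HasFixedPointCycle {n} ℓ = Σ (Cycle n) λ C → FixedPointCycle ℓ C

{-# OPTIONS --safe #-}
-- Fix a vertex t and a colour z, and grow a set L of colours at some vertex w
-- from which a path ends in colour z at t, keeping the unvisited vertices A in
-- reserve.  For a, b in A, pulling L back along a → w and along a → b → w gives
-- two sets of colours at a.  If they differ for some pair, their union is
-- larger than L and only two vertices were spent.  If they agree for every
-- pair, the labels carry these sets to one another, so they can be discarded
-- and the argument restarts on A with fewer colours.  When L contains every
-- colour, the colour mapped to z by the edge t → w closes a cycle.
module Submission where

open import Defs
open import Data.Nat using (ℕ; zero; suc; _+_; _≤_; _<_; _*_; _∸_; z≤n; s≤s; s≤s⁻¹)
open import Data.Nat.Properties
  using (≤-trans; ≤-reflexive; ≤-<-trans; <-irrefl; *-comm; +-suc; +-identityʳ;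
         m<m+n; n≤1+n; 1+n≢n)
open import Data.Nat.DivMod using (_%_; m<n⇒m%n≡m; n%n≡0)
open import Data.Fin using (Fin; zero; suc; toℕ; fromℕ; inject₁)
open import Data.Fin.Properties
  using (_≟_; toℕ-injective; toℕ-fromℕ<; toℕ-fromℕ; toℕ-inject₁; toℕ<n; any?)
open import Data.Fin.Permutation using (Permutation′; _⟨$⟩ʳ_; _⟨$⟩ˡ_; inverseˡ; inverseʳ; id)
open import Data.Fin.Relation.Unary.Top using (view; ‵fromℕ; ‵inject₁)
open import Data.List using (List; []; _∷_; length; map; filter; tabulate; allFin)
open import Data.List.Properties using (length-map; length-tabulate; filter-notAll)
open import Data.List.Membership.Propositional using (_∈_; _∉_; find; lose)
import Data.List.Membership.DecPropositional as DecMembership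
open import Data.List.Membership.Propositional.Properties
  using (∈-map⁺; ∈-map⁻; ∈-filter⁺; ∈-filter⁻; ∈-allFin)
open import Data.List.Relation.Binary.Subset.Propositional using (_⊆_)
open import Data.List.Relation.Unary.All as All using (All; []; _∷_)
open import Data.List.Relation.Unary.All.Properties using (¬Any⇒All¬)
open import Data.List.Relation.Unary.Any using (Any; here; there)
open import Data.List.Relation.Unary.AllPairs as AllPairs using ([]; _∷_)
open import Data.List.Relation.Unary.Unique.Propositional using (Unique)
open import Data.List.Relation.Unary.Unique.Propositional.Properties as Unique
  using (Unique[x∷xs]⇒x∉xs)
open import Data.Product using (∃; _×_; _,_; proj₁; proj₂)
open import Data.Sum using (_⊎_; inj₁; inj₂; swap) renaming (map to map⊎)
open import Data.Vec.Functional as Vector using (Vector)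
open import Function using (_∘_; case_of_)
open import Function.Bundles using (_⇔_; mk⇔; Equivalence)
open import Function.Definitions using (Injective)
open import Relation.Binary.PropositionalEquality
  using (_≡_; _≢_; refl; sym; trans; cong; subst)
open import Relation.Nullary using (yes; no; contradiction; ¬?)
open import Relation.Nullary.Decidable using (decidable-stable; toSum)

open Equivalence using (to; from)

-- Duplicate-free lists over a finite set.

infixl 6 _∖_

_∖_ : ∀ {k} → List (Fin k) → Fin k → List (Fin k)
xs ∖ x = filter (λ y → ¬? (x ≟ y)) xs

module _ {k : ℕ} where

  private
    _∈?_ = DecMembership._∈?_ (_≟_ {k})

  unique-∷ : ∀ {x : Fin k} {xs} → x ∉ xs → Unique xs → Unique (x ∷ xs)
  unique-∷ x∉xs xs! = ¬Any⇒All¬ _ x∉xs ∷ xs!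

  ∈-∖⁺ : ∀ {x y : Fin k} {xs} → y ∈ xs → x ≢ y → y ∈ xs ∖ x
  ∈-∖⁺ = ∈-filter⁺ _

  ∖-⊆ : ∀ {x : Fin k} xs → xs ∖ x ⊆ xs
  ∖-⊆ xs y∈ = proj₁ (∈-filter⁻ _ {xs = xs} y∈)

  ∉-∖ : ∀ {x : Fin k} xs → x ∉ xs ∖ x
  ∉-∖ xs x∈ = proj₂ (∈-filter⁻ _ {xs = xs} x∈) refl

  unique-∖ : ∀ {x : Fin k} {xs} → Unique xs → Unique (xs ∖ x)
  unique-∖ = Unique.filter⁺ _

  length-mono-⊆ : ∀ {xs ys : List (Fin k)} → Unique xs → xs ⊆ ys → length xs ≤ length ys
  length-mono-⊆ {[]} _ _ = z≤n
  length-mono-⊆ {x ∷ xs} {ys} xxs!@(_ ∷ xs!) xxs⊆ys =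
    ≤-trans
      (s≤s (length-mono-⊆ xs! λ y∈xs →
        ∈-∖⁺ (xxs⊆ys (there y∈xs)) λ { refl → Unique[x∷xs]⇒x∉xs xxs! y∈xs }))
      -- `x` lies in `ys` and fails the filter, so removing it shortens `ys` strictly.
      (filter-notAll _ ys (lose (xxs⊆ys (here refl)) λ x≢x → x≢x refl))

  length-∖ : ∀ {x : Fin k} {xs} → Unique xs → length xs ≤ suc (length (xs ∖ x))
  length-∖ {x} {xs} xs! = length-mono-⊆ {ys = x ∷ xs ∖ x} xs! split
    where
    split : xs ⊆ x ∷ xs ∖ x
    split {y} y∈xs with x ≟ y
    ... | yes refl = here refl
    ... | no x≢y = there (∈-∖⁺ y∈xs x≢y)

  full⇒∈ : ∀ {xs : List (Fin k)} → Unique xs → length xs ≡ k → ∀ x → x ∈ xs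
  full⇒∈ {xs} xs! |xs|≡k x = decidable-stable (x ∈? xs) λ x∉xs →
    <-irrefl |xs|≡k (≤-trans
      (length-mono-⊆ (unique-∷ x∉xs xs!) (λ {y} _ → ∈-allFin y))
      (≤-reflexive (length-tabulate {n = k} _)))

  ∃-∉ : ∀ (xs : List (Fin k)) {e} → length xs + suc e ≡ k → ∃ λ x → x ∉ xs
  ∃-∉ xs {e} eq with any? (λ x → ¬? (x ∈? xs))
  ... | yes found = found
  ... | no none = contradiction
    (≤-trans (≤-reflexive (sym (length-tabulate {n = k} _)))
      (length-mono-⊆ (Unique.allFin⁺ k) λ {x} _ →
        decidable-stable (x ∈? xs) λ x∉xs → none (x , x∉xs)))
    (λ k≤|xs| → <-irrefl refl (≤-<-trans k≤|xs|
      (subst (length xs <_) eq (m<m+n (length xs) (s≤s z≤n)))))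

  -- Exactly one element is gained, even where the union is larger, so that the count of missing
  -- colours drops by one each time.
  Enlargement : List (Fin k) → List (Fin k) → Set
  Enlargement xs ys = ∃ λ zs →
    Unique zs × length zs ≡ suc (length xs) × (∀ {z} → z ∈ zs → z ∈ xs ⊎ z ∈ ys)

  enlarge : ∀ {xs ys : List (Fin k)} {y} → Unique xs → y ∈ ys → y ∉ xs → Enlargement xs ys
  enlarge {xs} {ys} {y} xs! y∈ys y∉xs =
    y ∷ xs , unique-∷ y∉xs xs! , refl , λ where
      (here refl) → inj₂ y∈ys
      (there z∈xs) → inj₁ z∈xs

  -- An element of either list outside the other can be added to that other list; equal lengths make
  -- the result one longer than `xs` in both cases.
  same-or-enlarge : ∀ {xs ys : List (Fin k)} → Unique xs → Unique ys → length xs ≡ length ys →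
                    (∀ x → x ∈ xs ⇔ x ∈ ys) ⊎ Enlargement xs ys
  same-or-enlarge {xs} {ys} xs! ys! |xs|≡|ys|
    with All.decide (λ x → toSum (x ∈? ys)) xs | All.decide (λ y → toSum (y ∈? xs)) ys
  ... | _ | inj₂ ys⊈xs =
    let _ , y∈ys , y∉xs = find ys⊈xs in inj₂ (enlarge xs! y∈ys y∉xs)
  ... | inj₂ xs⊈ys | _ =
    let _ , x∈xs , x∉ys = find xs⊈ys
        zs , zs! , |zs| , zs⊆ = enlarge ys! x∈xs x∉ys
    in inj₂ (zs , zs! , trans |zs| (cong suc (sym |xs|≡|ys|)) , swap ∘ zs⊆)
  ... | inj₁ xs⊆ys | inj₁ ys⊆xs = inj₁ λ _ → mk⇔ (All.lookup xs⊆ys) (All.lookup ys⊆xs)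

-- The cyclic successor of indices.

next-inject₁ : ∀ {m} (i : Fin m) → next (inject₁ i) ≡ suc i
next-inject₁ {m} i = toℕ-injective (trans (toℕ-fromℕ< _)
  (trans (m<n⇒m%n≡m (subst (λ j → suc j < suc m) (sym (toℕ-inject₁ i)) (s≤s (toℕ<n i))))
    (cong suc (toℕ-inject₁ i))))

next-fromℕ : ∀ m → next (fromℕ m) ≡ zero
next-fromℕ m = toℕ-injective (trans (toℕ-fromℕ< _)
  (trans (cong (λ j → suc j % suc m) (toℕ-fromℕ m)) (n%n≡0 (suc m))))

≢-next : ∀ {m} (i : Fin (suc (suc m))) → i ≢ next i
≢-next i with view i
... | ‵fromℕ = λ eq → case trans eq (next-fromℕ _) of λ ()
... | ‵inject₁ j = λ eq →
  1+n≢n (trans (sym (cong toℕ (trans eq (next-inject₁ j)))) (toℕ-inject₁ j))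

-- Coloured paths, and closing them into cycles.

module _ {n d : ℕ} (ℓ : Labeling n d) where

  -- Opaque so that u and v can be inferred from perm u v.
  opaque
    perm : Fin n → Fin n → Permutation′ d
    perm u v with u ≟ v
    ... | yes _ = id
    ... | no u≢v = ℓ u v u≢v

    -- refl suffices because proofs of u ≢ v are definitionally equal.
    perm-≢ : ∀ {u v} (u≢v : u ≢ v) → perm u v ≡ ℓ u v u≢v
    perm-≢ {u} {v} u≢v with u ≟ v
    ... | yes u≡v = contradiction u≡v u≢v
    ... | no _ = refl

  -- Reading labels through the total function `perm` keeps adjacency proofs out of paths.
  follow : ∀ {k} → Vector (Fin n) (suc k) → Fin d → Fin d
  follow {zero} g x = x
  follow {suc k} g x = follow (g ∘ suc) (perm (g zero) (g (suc zero)) ⟨$⟩ʳ x)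

  -- Stated for any run `h` of consecutive indices, so that induction can drop the first one. The
  -- last edge is split off because in a whole cycle it is the one that wraps around.
  run-tabulate : ∀ (C : Cycle n) {k} (h : Vector (Fin (suc (suc (m C)))) (suc k)) →
                 (∀ i → next (h (inject₁ i)) ≡ h (suc i)) → ∀ x →
                 run ℓ C (tabulate h) x ≡
                 perm (vs C (h (fromℕ k))) (vs C (next (h (fromℕ k)))) ⟨$⟩ʳ follow (vs C ∘ h) x
  run-tabulate C {zero} h _ x = cong (_⟨$⟩ʳ x) (sym (perm-≢ (adj C (h zero))))
  run-tabulate C {suc k} h consecutive x = trans
    (run-tabulate C (h ∘ suc) (consecutive ∘ suc) _)
    (cong (λ y → perm (vs C (h (fromℕ (suc k)))) (vs C (next (h (fromℕ (suc k)))))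
                   ⟨$⟩ʳ follow (vs C ∘ h ∘ suc) y)
      (trans (cong (_⟨$⟩ʳ x) (sym (perm-≢ (adj C (h zero)))))
        (cong (λ j → perm (vs C (h zero)) (vs C j) ⟨$⟩ʳ x) (consecutive zero))))

  record Path (A : List (Fin n)) (u : Fin n) (x : Fin d) (v : Fin n) (y : Fin d) : Set where
    field
      {len}    : ℕ
      vertices : Vector (Fin n) (suc len)
      simple   : Injective _≡_ _≡_ vertices
      first    : vertices zero ≡ u
      last     : vertices (fromℕ len) ≡ v
      follows  : follow vertices x ≡ y
      avoids   : ∀ i → vertices i ∉ A
  open Path

  path-[] : ∀ {A t z} → t ∉ A → Path A t z t z
  path-[] {t = t} t∉A = record
    { len = 0
    ; vertices = λ _ → t
    ; simple = λ { {zero} {zero} _ → refl }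
    ; first = refl
    ; last = refl
    ; follows = refl
    ; avoids = λ _ → t∉A
    }

  -- The given path avoids all of `A`, so `a` is new to it and the longer path stays simple.
  path-∷ : ∀ {A A′ a w x t z} → a ∈ A → a ∉ A′ → A′ ⊆ A →
           Path A w (perm a w ⟨$⟩ʳ x) t z → Path A′ a x t z
  path-∷ {A} {A′} {a} {w} {x} a∈A a∉A′ A′⊆A p = record
    { vertices = a Vector.∷ vertices p
    ; simple = simple′
    ; first = refl
    ; last = last p
    ; follows = trans
        (cong (λ v → follow (vertices p) (perm a v ⟨$⟩ʳ x)) (first p)) (follows p)
    ; avoids = λ { zero → a∉A′ ; (suc i) → avoids p i ∘ A′⊆A }
    }
    where
    simple′ : Injective _≡_ _≡_ (a Vector.∷ vertices p)
    simple′ {zero} {zero} _ = refl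
    simple′ {zero} {suc j} a≡v = contradiction (subst (_∈ A) a≡v a∈A) (avoids p j)
    simple′ {suc i} {zero} v≡a = contradiction (subst (_∈ A) (sym v≡a) a∈A) (avoids p i)
    simple′ {suc i} {suc j} eq = cong suc (simple p eq)

  -- The path takes `x` at `w` to `z` at `t`, and the edge from `t` to `w` takes `z` back to `x`. As
  -- `w ≢ t`, there are at least two vertices.
  close : ∀ {A w x t z} → w ≢ t → Path A w x t z → perm t w ⟨$⟩ʳ z ≡ x → HasFixedPointCycle ℓ
  close w≢t record { len = zero ; first = refl ; last = refl } _ = contradiction refl w≢t
  close {x = x} w≢t record { len = suc k ; vertices = g ; simple = g-injective
                           ; first = refl ; last = refl ; follows = refl } closing =
    C , x , trans (run-tabulate C (λ i → i) next-inject₁ x)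
      (trans (cong (λ j → perm (g (fromℕ _)) (g j) ⟨$⟩ʳ follow g x) (next-fromℕ _)) closing)
    where
    C : Cycle n
    C = record { m = k ; vs = g ; inj = g-injective ; adj = λ i → ≢-next i ∘ g-injective }

  -- Preimages of colour sets, and frames of discarded colours.

  pull : Fin n → Fin n → List (Fin d) → List (Fin d)
  pull a w = map (perm a w ⟨$⟩ˡ_)

  ∈-pull : ∀ {a w L x} → x ∈ pull a w L ⇔ perm a w ⟨$⟩ʳ x ∈ L
  ∈-pull {a} {w} {L} {x} = mk⇔ fwd bwd
    where
    fwd : x ∈ pull a w L → perm a w ⟨$⟩ʳ x ∈ L
    fwd x∈ with ∈-map⁻ (perm a w ⟨$⟩ˡ_) x∈
    ... | y , y∈L , refl = subst (_∈ L) (sym (inverseʳ (perm a w))) y∈L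
    bwd : perm a w ⟨$⟩ʳ x ∈ L → x ∈ pull a w L
    bwd y∈L = subst (_∈ pull a w L) (inverseˡ (perm a w)) (∈-map⁺ _ y∈L)

  pull-unique : ∀ {a w L} → Unique L → Unique (pull a w L)
  pull-unique {a} {w} = Unique.map⁺ λ eq →
    trans (sym (inverseʳ (perm a w))) (trans (cong (perm a w ⟨$⟩ʳ_) eq) (inverseʳ (perm a w)))

  length-pull : ∀ {a w} L → length (pull a w L) ≡ length L
  length-pull = length-map _

  -- F v is the list of discarded colours at v; e colours are left at every vertex.
  record Frame (V : List (Fin n)) (e : ℕ) : Set where
    field
      V-unique : Unique V
      F        : Fin n → List (Fin d)
      F-unique : ∀ {v} → v ∈ V → Unique (F v)
      F-size   : ∀ {v} → v ∈ V → length (F v) + e ≡ d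
      closed   : ∀ {u v} → u ∈ V → v ∈ V → u ≢ v → ∀ x → x ∈ F u ⇔ perm u v ⟨$⟩ʳ x ∈ F v

  -- Growing a colour list within a frame.

  module _ {V c} (𝓕 : Frame V c) where
    open Frame 𝓕

    -- Carrying the discarded colours along in the colour lists keeps these lists
    -- closed under pull, so that a list of length d leaves no colour out.
    Good : List (Fin n) → Fin n → Fin n → Fin d → Fin d → Set
    Good A t w z x = x ∈ F w ⊎ Path A w x t z

    -- A discarded colour pulls back to a discarded one by `closed`; a path from `w` is prefixed
    -- with the reserve vertex `a`.
    pull-good : ∀ {A A′ a w t z L x} → w ∈ V → a ∈ V → a ≢ w →
                a ∈ A → a ∉ A′ → A′ ⊆ A →
                (∀ {y} → y ∈ L → Good A t w z y) → x ∈ pull a w L → Good A′ t a z x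
    pull-good w∈V a∈V a≢w a∈A a∉A′ A′⊆A good x∈ with good (to ∈-pull x∈)
    ... | inj₁ y∈F = inj₁ (from (closed a∈V w∈V a≢w _) y∈F)
    ... | inj₂ p = inj₂ (path-∷ a∈A a∉A′ A′⊆A p)

    -- A stage of the growth: `e` colours are still absent from `L`, and `A` is the reserve.
    record Front (t : Fin n) (z : Fin d) (w : Fin n) (A : List (Fin n)) (e : ℕ) : Set where
      field
        w∈V      : w ∈ V
        A⊆V      : A ⊆ V
        w∉A      : w ∉ A
        t∉A      : t ∉ A
        A-unique : Unique A
        L        : List (Fin d)
        L-unique : Unique L
        L-size   : length L + e ≡ d
        good     : ∀ {x} → x ∈ L → Good A t w z x

    -- `L` holds every colour, in particular the image of `z` at `w`. That image is not discarded,
    -- since `closed` would then put `z` in `F t`; so it starts a path to `t`, which the edge from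
    -- `t` to `w` closes.
    finish : ∀ {t z w A} → t ∈ V → z ∉ F t → w ≢ t → Front t z w A 0 → HasFixedPointCycle ℓ
    finish {t} {z} {w} t∈V z∉F w≢t fr
      with good (full⇒∈ L-unique (trans (sym (+-identityʳ _)) L-size) (perm t w ⟨$⟩ʳ z))
      where open Front fr
    ... | inj₁ y∈F =
      contradiction (from (closed t∈V (Front.w∈V fr) (w≢t ∘ sym) z) y∈F) z∉F
    ... | inj₂ p = close w≢t p refl

    -- Put `F v = pull v w L`. Agreement at `a` and `b` says that a colour lies in `F a` exactly
    -- when its image lies in `F b`, which is `closed` for the new frame. A disagreement makes `a`
    -- the new endpoint.
    enlarge-or-reframe : ∀ {t z w A e} → Front t z w A (suc e) →
      (∃ λ a → ∃ λ b → a ∈ A × Front t z a (A ∖ b ∖ a) e × length A ≤ suc (suc (length (A ∖ b ∖ a))))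
      ⊎ Frame A (suc e)
    enlarge-or-reframe {t} {z} {w} {A} {e} fr = conclude (All.decide pairs A)
      where
      open Front fr

      Agree Differ : Fin n → Fin n → Set
      Agree a b = a ≢ b → ∀ x → x ∈ pull a w L ⇔ x ∈ pull a b (pull b w L)
      Differ a b = a ≢ b × Enlargement (pull a w L) (pull a b (pull b w L))

      compare : ∀ a b → Agree a b ⊎ Differ a b
      compare a b = case toSum (a ≟ b) of λ where
        (inj₁ a≡b) → inj₁ (contradiction a≡b)
        (inj₂ a≢b) → map⊎ (λ same _ → same) (a≢b ,_)
          (same-or-enlarge (pull-unique L-unique) (pull-unique (pull-unique L-unique))
            (trans (length-pull L) (sym (trans (length-pull (pull b w L)) (length-pull L)))))

      pairs : ∀ a → All (Agree a) A ⊎ Any (Differ a) A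
      pairs a = All.decide (compare a) A

      ≢w : ∀ {a} → a ∈ A → a ≢ w
      ≢w a∈A refl = w∉A a∈A

      conclude : All (λ a → All (Agree a) A) A ⊎ Any (λ a → Any (Differ a) A) A → _
      conclude (inj₁ agree) = inj₂ (record
        { V-unique = A-unique
        ; F = λ v → pull v w L
        ; F-unique = λ _ → pull-unique L-unique
        ; F-size = λ _ → trans (cong (_+ suc e) (length-pull L)) L-size
        ; closed = λ u∈A v∈A u≢v x →
            let same = All.lookup (All.lookup agree u∈A) v∈A u≢v x
            in mk⇔ (to ∈-pull ∘ to same) (from same ∘ from ∈-pull)
        })
      conclude (inj₂ differ) with find differ
      ... | a , a∈A , differ-a with find differ-a
      ... | b , b∈A , a≢b , L′ , L′! , |L′| , L′⊆ = inj₁ (a , b , a∈A , record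
        { w∈V = A⊆V a∈A
        ; A⊆V = A⊆V ∘ A″⊆A
        ; w∉A = ∉-∖ A′
        ; t∉A = t∉A ∘ A″⊆A
        ; A-unique = unique-∖ A′!
        ; L = L′
        ; L-unique = L′!
        ; L-size = trans (cong (_+ e) (trans |L′| (cong suc (length-pull L))))
                     (trans (sym (+-suc (length L) e)) L-size)
        ; good = good′ ∘ L′⊆
        -- As `A` has no repetitions, removing `b` and then `a` costs at most two vertices.
        } , ≤-trans (length-∖ A-unique) (s≤s (length-∖ A′!)))
        where
        A′ = A ∖ b
        A′! : Unique A′
        A′! = unique-∖ A-unique
        A″⊆A : A′ ∖ a ⊆ A
        A″⊆A = ∖-⊆ A ∘ ∖-⊆ A′
        good′ : ∀ {x} → x ∈ pull a w L ⊎ x ∈ pull a b (pull b w L) → Good (A′ ∖ a) t a z x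
        good′ (inj₁ x∈) = pull-good w∈V (A⊆V a∈A) (≢w a∈A) a∈A (∉-∖ A′) A″⊆A good x∈
        good′ (inj₂ x∈) =
          -- On the route through `b`, first `b` leaves the reserve, then `a`.
          pull-good (A⊆V b∈A) (A⊆V a∈A) a≢b (∈-∖⁺ a∈A (a≢b ∘ sym)) (∉-∖ A′) (∖-⊆ A′)
            (pull-good w∈V (A⊆V b∈A) (≢w b∈A) b∈A (∉-∖ A) (∖-⊆ A) good) x∈

  -- Induction on the number of colours left.

  initial-front : ∀ {t A e z} (𝓕 : Frame (t ∷ A) (suc e)) → z ∉ Frame.F 𝓕 t → Front 𝓕 t z t A e
  initial-front {t} {A} {e} {z} 𝓕 z∉F = record
    { w∈V = here refl
    ; A⊆V = there
    ; w∉A = Unique[x∷xs]⇒x∉xs V-unique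
    ; t∉A = Unique[x∷xs]⇒x∉xs V-unique
    ; A-unique = AllPairs.tail V-unique
    -- `z` starts the trivial path at `t`, so one colour fewer is missing than the frame leaves.
    ; L = z ∷ F t
    ; L-unique = unique-∷ z∉F (F-unique (here refl))
    ; L-size = trans (sym (+-suc (length (F t)) e)) (F-size (here refl))
    ; good = λ where
        (here refl) → inj₂ (path-[] (Unique[x∷xs]⇒x∉xs V-unique))
        (there x∈F) → inj₁ x∈F
    }
    where open Frame 𝓕

  -- Spends a vertex without gaining a colour, to move off `t` when the list is already full there
  -- and no edge can close a cycle yet.
  shift-front : ∀ {V c t z w a A e} (𝓕 : Frame V c) →
                Front 𝓕 t z w (a ∷ A) e → Front 𝓕 t z a A e
  shift-front {w = w} {a = a} 𝓕 fr = record
    { w∈V = A⊆V (here refl)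
    ; A⊆V = A⊆V ∘ there
    ; w∉A = Unique[x∷xs]⇒x∉xs A-unique
    ; t∉A = t∉A ∘ there
    ; A-unique = AllPairs.tail A-unique
    ; L = pull a w L
    ; L-unique = pull-unique L-unique
    ; L-size = trans (cong (_+ _) (length-pull L)) L-size
    ; good = pull-good 𝓕 w∈V (A⊆V (here refl)) (λ { refl → w∉A (here refl) })
               (here refl) (Unique[x∷xs]⇒x∉xs A-unique) there good
    }
    where open Front fr

  mutual
    -- Once `z` is chosen, each of the `e` missing colours costs two reserve vertices, and `t` is
    -- one more: `2e + 1`. The separate bound of two matters for `e = 0`, where a second vertex is
    -- needed for a cycle through `t`.
    from-frame : ∀ e {V} → Frame V (suc e) → 2 ≤ length V → suc (e * 2) ≤ length V →
                 HasFixedPointCycle ℓ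
    from-frame _ {_ ∷ []} _ (s≤s ()) _
    from-frame zero {t ∷ w ∷ A} 𝓕 _ _ =
      let z , z∉F = ∃-∉ (Frame.F 𝓕 t) (Frame.F-size 𝓕 (here refl))
          fr = initial-front 𝓕 z∉F
      in finish 𝓕 (here refl) z∉F (λ { refl → Front.t∉A fr (here refl) }) (shift-front 𝓕 fr)
    from-frame (suc e) {t ∷ w ∷ A} 𝓕 _ large =
      let z , z∉F = ∃-∉ (Frame.F 𝓕 t) (Frame.F-size 𝓕 (here refl))
      in step e 𝓕 (here refl) z∉F (initial-front 𝓕 z∉F) (s≤s⁻¹ large)

    step : ∀ e {V c t z w A} (𝓕 : Frame V c) → t ∈ V → z ∉ Frame.F 𝓕 t →
           Front 𝓕 t z w A (suc e) → suc e * 2 ≤ length A → HasFixedPointCycle ℓ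
    step e 𝓕 t∈V z∉F fr large with enlarge-or-reframe 𝓕 fr
    ... | inj₁ (a , b , a∈A , fr′ , shrink) =
      -- The new endpoint `a` lies in `A` and `t` does not, so they differ.
      advance e 𝓕 t∈V z∉F (λ { refl → Front.t∉A fr a∈A }) fr′
        (s≤s⁻¹ (s≤s⁻¹ (≤-trans large shrink)))
    ... | inj₂ 𝓕′ =
      -- The restart needs `2e + 1` vertices and at least two; the reserve has `2e + 2`.
      from-frame e 𝓕′ (≤-trans (s≤s (s≤s z≤n)) large) (≤-trans (n≤1+n _) large)

    advance : ∀ e {V c t z w A} (𝓕 : Frame V c) → t ∈ V → z ∉ Frame.F 𝓕 t → w ≢ t →
              Front 𝓕 t z w A e → e * 2 ≤ length A → HasFixedPointCycle ℓ
    advance zero 𝓕 t∈V z∉F w≢t fr _ = finish 𝓕 t∈V z∉F w≢t fr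
    advance (suc e) 𝓕 t∈V z∉F _ fr large = step e 𝓕 t∈V z∉F fr large

theorem4 : (d : ℕ) → 2 ≤ d → (n : ℕ) → 2 * d ∸ 1 ≤ n →
    (ℓ : Labeling n d) → HasFixedPointCycle ℓ
theorem4 (suc zero) (s≤s ()) n _ ℓ
theorem4 (suc (suc e)) _ n large ℓ = from-frame ℓ (suc e) frame
  (≤-trans (s≤s (s≤s z≤n)) bound) bound
  where
  bound : suc (suc e * 2) ≤ length (allFin n)
  bound = ≤-trans
    -- With the product commuted, `k ∸ 1` computes to `suc (suc e * 2)`.
    (subst (λ k → k ∸ 1 ≤ n) (*-comm 2 (suc (suc e))) large)
    (≤-reflexive (sym (length-tabulate {n = n} _)))
  frame : Frame ℓ (allFin n) (suc (suc e))
  frame = record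
    { V-unique = Unique.allFin⁺ n
    ; F = λ _ → []
    ; F-unique = λ _ → []
    ; F-size = λ _ → refl
    ; closed = λ _ _ _ _ → mk⇔ (λ ()) (λ ())
    }
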